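{- Let $\mathcal V$ be an $\infty$-variety of languages containing only (edge-labelled) positional languages. Then $\mathcal V$ contains no non-trivial prefix-independent language; that is, for every finite alphabet $\Sigma$ and every prefix-independent $L\in\mathcal V(\Sigma)$, $L\cap\Sigma^\omega\in\{\emptyset,\Sigma^\omega\}$.
   Context: **Varieties.** $\Sigma^\infty$ denotes the set of finite and infinite words over $\Sigma$, viewed as the free $\omega$-semigroup $(\Sigma^+,\Sigma^\omega)$. (An $\omega$-semigroup is a pair $(S_+,S_\omega)$ of a semigroup and a set with a mixed product $S_+\times S_\omega\to S_\omega$ and an infinite product $S_+^\omega\to S_\omega$ satisfying the natural associativity laws.) A language $L\subseteq\Sigma^\infty$ is recognisable if it is the inverse image of a subset of $S_+\cup S_\omega$ under a morphism from the free $\omega$-semigroup to a finite $\omega$-semigroup. An $\infty$-variety $\mathcal V$ assigns to each finite alphabet $\Sigma$ a set $\mathcal V(\Sigma)$ of recognisable languages of $\Sigma^\infty$, closed under Boolean operations, under residuals ($L\mapsto u^{ -1}L=\{x\mid ux\in L\}$), and under preimages of $\omega$-semigroup morphisms between free $\omega$-semigroups (if $\varphi:A^\infty\to B^\infty$ is such a morphism and $L\in\mathcal V(B)$ then $\varphi^{ -1}(L)\in\mathcal V(A)$). Properties of $\omega$-languages are applied to $L\subseteq\Sigma^\infty$ via $L\cap\Sigma^\omega$: $L$ is prefix-independent (positional) if $L\cap\Sigma^\omega$ is. A language $K\subseteq\Sigma^\omega$ is prefix-independent if for all $x\in\Sigma^\omega,u\in\Sigma^*$: $x\in K\iff ux\in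 K$. **Games.** An edge-labelled arena is a tuple $(V_1,V_2,\delta)$ where $V_1,V_2$ are disjoint finite sets of states controlled by Player 1 and Player 2, $V=V_1\sqcup V_2$, and $\delta\subseteq V\times\Sigma\times V$ is total. For $e=(v,c,v')\in\delta$ write $src(e)=v$, $col(e)=c$, $tgt(e)=v'$. A strategy is a function $\sigma:V\cup\delta^+\to\delta$ with $src(\sigma(v))=v$ and $src(\sigma(we))=tgt(e)$ for $v\in V$, $w\in\delta^*$, $e\in\delta$. A positional strategy is a function $\sigma:V\to\delta$ with $src(\sigma(v))=v$. Strategies $\sigma_1,\sigma_2$ and an initial state $q$ determine a play $\varsigma\in\delta^\omega$: if the current state lies in $V_i$, the next edge is given by $\sigma_i$ applied to the history of edges so far (to $q$ at the first step; to the current state if $\sigma_i$ is positional). Its trace is $col(\varsigma[0])col(\varsigma[1])\cdots$. A strategy $\sigma_1$ is winning for Player 1 from $q$ with objective $K$ if for every $\sigma_2$ the trace of the play from $q$ lies in $K$. $K\subseteq\Sigma^\omega$ is (edge-labelled) positional if for every edge-labelled arena, every $W\subseteq V$, and every strategy winning for Player 1 (objective $K$) from all states of $W$, there is a single positional strategy winning for Player 1 from all states of $W$. -}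

module Defs where

open import Algebra.Bundles using (Semigroup; RawMagma)
open import Algebra.Morphism.Structures using (IsMagmaHomomorphism)
open import Data.Fin.Base using (Fin)
open import Data.List.Base using (List; []; _∷_; _++_)
open import Data.List.NonEmpty.Base as List⁺
  using (List⁺; _∷_; head; tail; toList; last; foldr₁; _⁺++⁺_; _++⁺_; _⁺∷ʳ_)
open import Data.List.NonEmpty.Properties using (⁺++⁺-assoc)
open import Data.Nat.Base using (ℕ; zero; suc; _<_; s<s)
open import Data.Nat.Properties using (n<1+n; m<n⇒m<1+n; <-≤-trans)
open import Data.Product.Base using (∃; ∃₂; _×_; _,_; proj₁; proj₂)
open import Data.Refinement.Base using (Refinement; value)
open import Data.Sum.Base as Sum using (_⊎_; inj₁; inj₂; [_,_]′)
open import Data.Sum.Relation.Binary.Pointwise using (_⊎ₛ_)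
open import Function.Base using (_∘_; const)
open import Function.Bundles using (Inverse; _⇔_)
open import Level using (Level; 0ℓ; _⊔_) renaming (suc to lsuc)
open import Relation.Binary.Bundles using (Setoid)
open import Relation.Binary.Definitions using (_Respects_)
open import Relation.Binary.PropositionalEquality
  using (_≡_; refl; sym; trans; _≗_; _→-setoid_)
import Relation.Binary.PropositionalEquality as ≡
open import Relation.Unary using (Pred; _∈_; _∪_; _∩_; ∁; _⊢_; _≐_)

Finite : Setoid 0ℓ 0ℓ → Set
Finite S = ∃ λ n → Inverse S (≡.setoid (Fin n))

record FiniteSet : Set₁ where
  field
    Carrier : Set
    finite  : Finite (≡.setoid Carrier)

infixr 5 _∷ω_ _++ω_

-- Infinite words are compared pointwise (_≗_), there being no function
-- extensionality.
ωWord : Set → Set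
ωWord A = ℕ → A

_∷ω_ : {A : Set} → A → ωWord A → ωWord A
(a ∷ω x) zero    = a
(a ∷ω x) (suc n) = x n

_++ω_ : {A : Set} → List A → ωWord A → ωWord A
[]      ++ω x = x
(a ∷ u) ++ω x = a ∷ω (u ++ω x)

-- a u w₀ w₁ w₂ …
concatFrom : {A : Set} → A → List A → (ℕ → List⁺ A) → ωWord A
concatFrom a u       w zero    = a
concatFrom a []      w (suc n) = concatFrom (head (w 0)) (tail (w 0)) (w ∘ suc) n
concatFrom a (b ∷ u) w (suc n) = concatFrom b u w n

-- w₀ w₁ w₂ …
concatω : {A : Set} → (ℕ → List⁺ A) → ωWord A
concatω w = concatFrom (head (w 0)) (tail (w 0)) (w ∘ suc)

record ωSemigroup : Set₁ where
  field
    semigroup : Semigroup 0ℓ 0ℓ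
    ωSetoid   : Setoid 0ℓ 0ℓ

  open Semigroup semigroup public
    renaming (Carrier to S₊; _≈_ to _≈₊_; setoid to setoid₊)
    using (_∙_; rawMagma)
  open Setoid ωSetoid public
    renaming (Carrier to Sω; _≈_ to _≈ω_)
    using ()

  infixr 7 _⊙_

  field
    _⊙_    : S₊ → Sω → Sω
    π      : (ℕ → S₊) → Sω
    ⊙-cong : ∀ {s t x y} → s ≈₊ t → x ≈ω y → (s ⊙ x) ≈ω (t ⊙ y)
    π-cong : ∀ {f g} → (∀ n → f n ≈₊ g n) → π f ≈ω π g

    ⊙-assoc : ∀ s t x → ((s ∙ t) ⊙ x) ≈ω (s ⊙ (t ⊙ x))
    π-cons  : ∀ s f → (s ⊙ π f) ≈ω π (s ∷ω f)
    -- A factorisation of a sequence s₀ s₁ s₂ … into finite nonempty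
    -- blocks is given by the sequence w of its blocks; the sequence
    -- itself is then concatω w.
    π-assoc : ∀ (w : ℕ → List⁺ S₊) → π (foldr₁ _∙_ ∘ w) ≈ω π (concatω w)

  setoid∞ : Setoid 0ℓ 0ℓ
  setoid∞ = setoid₊ ⊎ₛ ωSetoid

  open Setoid setoid∞ public
    renaming (Carrier to S∞; _≈_ to _≈∞_)
    using ()

record IsFinite (S : ωSemigroup) : Set where
  open ωSemigroup S
  field
    finite₊ : Finite setoid₊
    finiteω : Finite ωSetoid

record ωMorphism (S T : ωSemigroup) : Set where
  private
    module S = ωSemigroup S
    module T = ωSemigroup T
  field
    ⟦_⟧₊ : S.S₊ → T.S₊
    ⟦_⟧ω : S.Sω → T.Sω
    isMagmaHomomorphism : IsMagmaHomomorphism S.rawMagma T.rawMagma ⟦_⟧₊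
    ⟦⟧ω-cong : ∀ {x y} → x S.≈ω y → ⟦ x ⟧ω T.≈ω ⟦ y ⟧ω
    ⊙-homo   : ∀ s x → ⟦ s S.⊙ x ⟧ω T.≈ω (⟦ s ⟧₊ T.⊙ ⟦ x ⟧ω)
    π-homo   : ∀ f → ⟦ S.π f ⟧ω T.≈ω T.π (⟦_⟧₊ ∘ f)

  ⟦_⟧∞ : S.S∞ → T.S∞
  ⟦_⟧∞ = Sum.map ⟦_⟧₊ ⟦_⟧ω

module _ {A : Set} where

  ++ω-cong : ∀ (u : List A) {x y} → x ≗ y → (u ++ω x) ≗ (u ++ω y)
  ++ω-cong []      eq n       = eq n
  ++ω-cong (a ∷ u) eq zero    = refl
  ++ω-cong (a ∷ u) eq (suc n) = ++ω-cong u eq n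

  ++ω-assoc : ∀ (u v : List A) x → ((u ++ v) ++ω x) ≗ (u ++ω (v ++ω x))
  ++ω-assoc []      v x n       = refl
  ++ω-assoc (a ∷ u) v x zero    = refl
  ++ω-assoc (a ∷ u) v x (suc n) = ++ω-assoc u v x n

  concatFrom-cong : ∀ (a : A) u {w w′} → w ≗ w′ →
                    concatFrom a u w ≗ concatFrom a u w′
  concatFrom-cong a u       eq zero    = refl
  concatFrom-cong a []      {w′ = w′} eq (suc n) rewrite eq 0 =
    concatFrom-cong (head (w′ 0)) (tail (w′ 0)) (eq ∘ suc) n
  concatFrom-cong a (b ∷ u) eq (suc n) = concatFrom-cong b u eq n

  concatω-cong : {w w′ : ℕ → List⁺ A} → w ≗ w′ → concatω w ≗ concatω w′
  concatω-cong {w′ = w′} eq n rewrite eq 0 =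
    concatFrom-cong (head (w′ 0)) (tail (w′ 0)) (eq ∘ suc) n

  concatFrom-++ω : ∀ (a : A) u w → concatFrom a u w ≗ ((a ∷ u) ++ω concatω w)
  concatFrom-++ω a u       w zero    = refl
  concatFrom-++ω a []      w (suc n) = refl
  concatFrom-++ω a (b ∷ u) w (suc n) = concatFrom-++ω b u w n

  concatω-unfold : ∀ (w : ℕ → List⁺ A) →
                   concatω w ≗ (toList (w 0) ++ω concatω (w ∘ suc))
  concatω-unfold w = concatFrom-++ω (head (w 0)) (tail (w 0)) (w ∘ suc)

module _ {A : Set} where

  concatω-∷ω : ∀ (u : List⁺ A) w →
               (toList u ++ω concatω w) ≗ concatω (u ∷ω w)
  concatω-∷ω u w n = sym (concatω-unfold (u ∷ω w) n)

  concatω-++ω : ∀ u us (w : ℕ → List⁺ A) →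
                concatω ((u ∷ us) ++ω w)
                ≗ (toList (foldr₁ _⁺++⁺_ (u ∷ us)) ++ω concatω w)
  concatω-++ω u []       w n = concatω-unfold (u ∷ω w) n
  concatω-++ω u (v ∷ us) w n =
    trans (concatω-unfold (u ∷ω ((v ∷ us) ++ω w)) n)
    (trans (++ω-cong (toList u) (concatω-++ω v us w) n)
           (sym (++ω-assoc (toList u) (toList (foldr₁ _⁺++⁺_ (v ∷ us)))
                           (concatω w) n)))

  ++ω-cong-< : ∀ (u : List A) {x y} n → (∀ m → m < suc n → x m ≡ y m) →
               (u ++ω x) n ≡ (u ++ω y) n
  ++ω-cong-< []      n       eq = eq n (n<1+n n)
  ++ω-cong-< (a ∷ u) zero    eq = refl
  ++ω-cong-< (a ∷ u) (suc n) eq =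
    ++ω-cong-< u n (λ m m<1+n → eq m (m<n⇒m<1+n m<1+n))

  concatω-assoc-< : ∀ n (w : ℕ → List⁺ (List⁺ A)) m → m < n →
                    concatω (foldr₁ _⁺++⁺_ ∘ w) m ≡ concatω (concatω w) m
  concatω-assoc-< (suc n) w m m<1+n = trans (concatω-unfold (foldr₁ _⁺++⁺_ ∘ w) m)
    (trans (step m m<1+n)
    (trans (sym (concatω-++ω (head (w 0)) (tail (w 0)) (concatω (w ∘ suc)) m))
           (sym (concatω-cong (concatω-unfold w) m))))
    where
    u : List⁺ A
    u = foldr₁ _⁺++⁺_ (w 0)

    step : ∀ m → m < suc n →
           (toList u ++ω concatω (foldr₁ _⁺++⁺_ ∘ w ∘ suc)) m
           ≡ (toList u ++ω concatω (concatω (w ∘ suc))) m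
    step zero    _         = refl
    step (suc m) (s<s m<n) = ++ω-cong-< (tail u) m
      (λ k k<1+m → concatω-assoc-< n (w ∘ suc) k (<-≤-trans k<1+m m<n))

  concatω-assoc : ∀ (w : ℕ → List⁺ (List⁺ A)) →
                  concatω (foldr₁ _⁺++⁺_ ∘ w) ≗ concatω (concatω w)
  concatω-assoc w n = concatω-assoc-< (suc n) w n (n<1+n n)

⁺++⁺-semigroup : Set → Semigroup 0ℓ 0ℓ
⁺++⁺-semigroup A = record
  { Carrier     = List⁺ A
  ; _≈_         = _≡_
  ; _∙_         = _⁺++⁺_
  ; isSemigroup = record
    { isMagma = ≡.isMagma _⁺++⁺_
    ; assoc   = ⁺++⁺-assoc
    }
  }

Free : Set → ωSemigroup
Free A = record
  { semigroup = ⁺++⁺-semigroup A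
  ; ωSetoid   = ℕ →-setoid A
  ; _⊙_       = λ u x → toList u ++ω x
  ; π         = concatω
  ; ⊙-cong    = λ { {s} refl x≗y → ++ω-cong (toList s) x≗y }
  ; π-cong    = concatω-cong
  ; ⊙-assoc   = λ u v x → ++ω-assoc (toList u) (toList v) x
  ; π-cons    = concatω-∷ω
  ; π-assoc   = concatω-assoc
  }

∞Word : Set → Set
∞Word A = List⁺ A ⊎ ωWord A

Language : Set → Set₁
Language A = Pred (∞Word A) 0ℓ

ωPart : {A : Set} → Language A → Pred (ωWord A) 0ℓ
ωPart L = inj₂ ⊢ L

record Recognisable {A : Set} (L : Language A) : Set₁ where
  field
    S        : ωSemigroup
    isFinite : IsFinite S
    φ        : ωMorphism (Free A) S

  open ωSemigroup S using (S∞; _≈∞_)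
  open ωMorphism φ using (⟦_⟧∞)

  field
    P          : Pred S∞ 0ℓ
    P-respects : P Respects _≈∞_
    preimage   : L ≐ (⟦_⟧∞ ⊢ P)

residual : {A : Set} → List A → Language A → Language A
residual u L = Sum.map (u ++⁺_) (u ++ω_) ⊢ L

record ∞Variety (v : Level) : Set (lsuc 0ℓ ⊔ lsuc v) where
  open FiniteSet using (Carrier)
  field
    𝓥 : (Σ : FiniteSet) → Pred (Language (Carrier Σ)) v

    -- 𝓥 Σ is a set of languages, i.e. of predicates up to
    -- extensional equality.
    𝓥-respects-≐ : ∀ {Σ} → 𝓥 Σ Respects _≐_

    recognisable : ∀ {Σ L} → L ∈ 𝓥 Σ → Recognisable L
    ∪-closed : ∀ {Σ L M} → L ∈ 𝓥 Σ → M ∈ 𝓥 Σ → (L ∪ M) ∈ 𝓥 Σ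
    ∩-closed : ∀ {Σ L M} → L ∈ 𝓥 Σ → M ∈ 𝓥 Σ → (L ∩ M) ∈ 𝓥 Σ
    ∁-closed : ∀ {Σ L} → L ∈ 𝓥 Σ → ∁ L ∈ 𝓥 Σ
    residual-closed : ∀ {Σ L} u → L ∈ 𝓥 Σ → residual u L ∈ 𝓥 Σ
    preimage-closed : ∀ {A B L}
      (φ : ωMorphism (Free (Carrier A)) (Free (Carrier B))) →
      L ∈ 𝓥 B → (ωMorphism.⟦_⟧∞ φ ⊢ L) ∈ 𝓥 A

PrefixIndependent : {A : Set} → Pred (ωWord A) 0ℓ → Set
PrefixIndependent K = ∀ x u → x ∈ K ⇔ (u ++ω x) ∈ K

record Arena (A : Set) : Set₁ where
  field
    V₁ V₂   : Set
    finite₁ : Finite (≡.setoid V₁)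
    finite₂ : Finite (≡.setoid V₂)

  V : Set
  V = V₁ ⊎ V₂

  field
    δ     : Pred (V × A × V) 0ℓ
    total : ∀ v → ∃₂ λ c v′ → (v , c , v′) ∈ δ

  -- Membership in δ is irrelevant, so that edges are equal as soon as
  -- the underlying triples are.
  Edge : Set
  Edge = Refinement (V × A × V) δ

  src : Edge → V
  src e = proj₁ (value e)

  col : Edge → A
  col e = proj₁ (proj₂ (value e))

  tgt : Edge → V
  tgt e = proj₂ (proj₂ (value e))

  -- V ∪ δ⁺, the domain of a strategy. As δ⁺ consists of all nonempty
  -- sequences of edges, a history need not be a path.
  History : Set
  History = V ⊎ List⁺ Edge

  current : History → V
  current = [ (λ v → v) , tgt ∘ last ]′

  snoc : History → Edge → List⁺ Edge
  snoc = [ const List⁺.[_] , _⁺∷ʳ_ ]′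

  record Strategy : Set where
    field
      move     : History → Edge
      move-src : ∀ h → src (move h) ≡ current h

  record PositionalStrategy : Set where
    field
      move     : V → Edge
      move-src : ∀ v → src (move v) ≡ v

  toStrategy : PositionalStrategy → Strategy
  toStrategy σ = record
    { move     = move ∘ current
    ; move-src = move-src ∘ current
    }
    where open PositionalStrategy σ

  module Play (σ₁ σ₂ : Strategy) (q : V) where

    next : History → Edge
    next h = [ const (Strategy.move σ₁ h) , const (Strategy.move σ₂ h) ]′ (current h)

    history : ℕ → History
    history zero    = inj₁ q
    history (suc n) = inj₂ (snoc (history n) (next (history n)))

    play : ℕ → Edge
    play n = next (history n)

    trace : ωWord A
    trace n = col (play n)

  Wins : Pred (ωWord A) 0ℓ → Strategy → V → Set
  Wins K σ₁ q = ∀ σ₂ → Play.trace σ₁ σ₂ q ∈ K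

Positional : {A : Set} → Pred (ωWord A) 0ℓ → Set₁
Positional {A} K =
  ∀ (G : Arena A) → let open Arena G in
  ∀ (W : Pred V 0ℓ) (σ : Strategy) →
  (∀ q → q ∈ W → Wins K σ q) →
  ∃ λ (τ : PositionalStrategy) → ∀ q → q ∈ W → Wins K (toStrategy τ) q

{-# OPTIONS --safe #-}

-- On the arena with a single state, owned by Player 1, and one loop per
-- letter, Player 1 can produce any ω-word x, and the positional
-- strategies produce exactly the words c c c …. Hence a positional
-- language that contains an ω-word contains some c c c ….
--
-- If L is non-trivial, this applied to L and to its complement gives
-- letters a, b with aaa… ∈ L and bbb… ∉ L. Up to complementing L and
-- exchanging a and b, prefix independence puts both ababab… and
-- bababa… in L. The intersection of the preimages of L under the
-- substitutions true, false ↦ a, b and true, false ↦ b, a then contains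
-- the alternating word but no constant word, so it is not positional.

module Submission where

open import Defs
open import Axiom.ExcludedMiddle using (ExcludedMiddle)
open import Data.Bool.Base using (Bool; true; false; not; if_then_else_)
open import Data.Bool.Properties using (if-not)
open import Data.Empty using (⊥)
open import Data.Fin.Properties using (0↔⊥; 1↔⊤; 2↔Bool)
open import Data.Irrelevant using ([_])
open import Data.List.Base as List using (List; []; _∷_)
open import Data.List.NonEmpty.Base as List⁺ using (List⁺; _∷_; head; tail)
open import Data.List.NonEmpty.Properties using (map-⁺++⁺)
open import Data.List.Properties using (length-++)
open import Data.Nat.Base using (ℕ; zero; suc)
open import Data.Nat.Properties using (+-comm)
open import Data.Product.Base using (∃; _,_; proj₁; proj₂)
open import Data.Refinement.Base using (_,_)
open import Data.Sum.Base using (_⊎_; inj₁; inj₂; [_,_]′)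
open import Data.Unit.Base using (⊤; tt)
open import Function.Base using (_∘_; const)
open import Function.Bundles using (Equivalence)
open import Function.Properties.Inverse using (↔-sym)
open import Level using (Level; 0ℓ)
open import Relation.Binary.Definitions using (_Respects_)
open import Relation.Binary.PropositionalEquality
  using (_≡_; _≗_; refl; sym; trans; cong)
open import Relation.Nullary using (¬_; yes; no)
open import Relation.Nullary.Decidable using (decidable-stable)
open import Relation.Unary using (Pred; _∈_; _∉_; _≐_; ∁; ∅; U)

-- Membership factors through the morphism `φ` and the predicate `P`, and both respect the
-- equalities of their domains. This supplies the invariance under `_≗_` that an arbitrary predicate
-- on ω-words may lack.
Recognisable⇒≗-respecting : ∀ {A} {L : Language A} → Recognisable L →
                            ωPart L Respects _≗_
Recognisable⇒≗-respecting R x≗y =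
  proj₂ preimage ∘ P-respects (inj₂ (⟦⟧ω-cong x≗y)) ∘ proj₁ preimage
  where
  open Recognisable R
  open import Data.Sum.Relation.Binary.Pointwise using (inj₂)
  open ωMorphism φ using (⟦⟧ω-cong)

module _ {A B : Set} (f : A → B) where

  map-++ω : ∀ (u : List A) x → (f ∘ (u ++ω x)) ≗ (List.map f u ++ω (f ∘ x))
  map-++ω []      x n       = refl
  map-++ω (a ∷ u) x zero    = refl
  map-++ω (a ∷ u) x (suc n) = map-++ω u x n

  map-concatFrom : ∀ a u w → (f ∘ concatFrom a u w) ≗
                   concatFrom (f a) (List.map f u) (List⁺.map f ∘ w)
  map-concatFrom a u       w zero    = refl
  map-concatFrom a []      w (suc n) =
    map-concatFrom (head (w 0)) (tail (w 0)) (w ∘ suc) n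
  map-concatFrom a (b ∷ u) w (suc n) = map-concatFrom b u w n

  mapMorphism : ωMorphism (Free A) (Free B)
  mapMorphism = record
    { ⟦_⟧₊ = List⁺.map f
    ; ⟦_⟧ω = f ∘_
    ; isMagmaHomomorphism = record
      { isRelHomomorphism = record { cong = cong (List⁺.map f) }
      ; homo              = map-⁺++⁺ f
      }
    ; ⟦⟧ω-cong = λ x≗y n → cong f (x≗y n)
    ; ⊙-homo   = λ u x → map-++ω (List⁺.toList u) x
    ; π-homo   = λ w → map-concatFrom (head (w 0)) (tail (w 0)) (w ∘ suc)
    }

length-⁺∷ʳ : ∀ {A : Set} (xs : List⁺ A) x →
             List⁺.length (xs List⁺.⁺∷ʳ x) ≡ suc (List⁺.length xs)
length-⁺∷ʳ (y ∷ ys) x = cong suc (trans (length-++ ys) (+-comm _ 1))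

-- The letter `a` guarantees a loop, as totality of `δ` requires.
bouquet : (A : Set) → A → Arena A
bouquet A a = record
  { V₁ = ⊤ ; V₂ = ⊥ ; finite₁ = 1 , ↔-sym 1↔⊤ ; finite₂ = 0 , ↔-sym 0↔⊥
  ; δ     = U
  ; total = λ v → a , v , _
  }

module _ {A : Set} {K : Pred (ωWord A) 0ℓ} (K-resp : K Respects _≗_) where

  positional⇒const : Positional K → ∀ x → x ∈ K → ∃ λ c → const c ∈ K
  positional⇒const K-pos x x∈K =
    col (PositionalStrategy.move τ q) , K-resp trace-τ (τ-wins q tt (toStrategy τ))
    where
    open Arena (bouquet A (x 0))

    q : V
    q = inj₁ tt

    only-q : ∀ v → q ≡ v
    only-q (inj₁ tt) = refl

    -- The only state carries no information, so `σ` finds its position in `x` by counting the edges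
    -- played; the initial history has none.
    time : History → ℕ
    time = [ const 0 , List⁺.length ]′

    σ : Strategy
    σ = record
      { move     = λ h → (q , x (time h) , q) , [ tt ]
      ; move-src = only-q ∘ current
      }

    module _ (σ₁ σ₂ : Strategy) where
      open Play σ₁ σ₂ q

      next≡move : ∀ h → next h ≡ Strategy.move σ₁ h
      -- `V₂` is empty; this match lets `next h` reduce to Player 1's move.
      next≡move h with inj₁ tt ← current h = refl

      time-snoc : ∀ h e → time (inj₂ (snoc h e)) ≡ suc (time h)
      time-snoc (inj₁ _)  e = refl
      time-snoc (inj₂ es) e = length-⁺∷ʳ es e

      time-history : ∀ n → time (history n) ≡ n
      time-history zero    = refl
      time-history (suc n) =
        trans (time-snoc (history n) _) (cong suc (time-history n))

    σ-wins : ∀ v → v ∈ U → Wins K σ v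
    σ-wins (inj₁ tt) _ σ₂ = K-resp
      (λ n → sym (trans (cong col (next≡move σ σ₂ (history n)))
                        (cong x (time-history σ σ₂ n))))
      x∈K
      where open Play σ σ₂ q

    τ : PositionalStrategy
    τ = proj₁ (K-pos (bouquet A (x 0)) U σ σ-wins)

    τ-wins : ∀ v → v ∈ U → Wins K (toStrategy τ) v
    τ-wins = proj₂ (K-pos (bouquet A (x 0)) U σ σ-wins)

    -- Player 2 never moves, so any strategy can serve as the opponent, `τ` included.
    open Play (toStrategy τ) (toStrategy τ) q

    trace-τ : trace ≗ const (col (PositionalStrategy.move τ q))
    trace-τ n =
      trans (cong col (next≡move (toStrategy τ) (toStrategy τ) (history n)))
            (cong (col ∘ PositionalStrategy.move τ)
                  (sym (only-q (current (history n)))))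

bool : FiniteSet
bool = record { Carrier = Bool ; finite = 2 , ↔-sym 2↔Bool }

alternating : ωWord Bool
alternating zero    = true
alternating (suc n) = not (alternating n)

module _ {A : Set} where

  choose : A → A → Bool → A
  choose a b c = if c then a else b

  alternate : A → A → ωWord A
  alternate a b = choose a b ∘ alternating

  alternate-∷ω : ∀ a b → ((b ∷ []) ++ω alternate a b) ≗ alternate b a
  alternate-∷ω a b zero    = refl
  alternate-∷ω a b (suc n) = sym (if-not (alternating n))

module _ {v : Level} (𝕍 : ∞Variety v)
         (positional : ∀ Σ L → L ∈ ∞Variety.𝓥 𝕍 Σ → Positional (ωPart L)) where
  open ∞Variety 𝕍

  const∈𝓥 : ∀ {Σ L} → L ∈ 𝓥 Σ → ∀ x → x ∈ ωPart L → ∃ λ c → const c ∈ ωPart L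
  const∈𝓥 L∈𝓥 =
    positional⇒const (Recognisable⇒≗-respecting (recognisable L∈𝓥))
                     (positional _ _ L∈𝓥)

  -- The two substitutions send each constant word over `Bool` to aaa... and bbb... in some order,
  -- so a constant word in both preimages puts bbb... in `L`.
  alternate⇒const : ∀ {Σ L} → L ∈ 𝓥 Σ → ∀ {a b} →
    alternate a b ∈ ωPart L → alternate b a ∈ ωPart L → ¬ const b ∉ ωPart L
  alternate⇒const L∈𝓥 {a} {b} ab∈L ba∈L b∉L
    with const∈𝓥 {bool}
           (∩-closed (preimage-closed (mapMorphism (choose a b)) L∈𝓥)
                     (preimage-closed (mapMorphism (choose b a)) L∈𝓥))
           alternating (ab∈L , ba∈L)
  ... | true  , _ , b∈L = b∉L b∈L
  ... | false , b∈L , _ = b∉L b∈L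

  module _ (em : ExcludedMiddle 0ℓ) {Σ : FiniteSet}
           {L : Language (FiniteSet.Carrier Σ)} (L∈𝓥 : L ∈ 𝓥 Σ)
           (L-pi : PrefixIndependent (ωPart L)) where

    shift : ∀ {a b} → alternate a b ∈ ωPart L → alternate b a ∈ ωPart L
    shift {a} {b} = Recognisable⇒≗-respecting (recognisable L∈𝓥) (alternate-∷ω a b)
                  ∘ Equivalence.to (L-pi (alternate a b) (b ∷ []))

    const-uniform : ∀ {a b} → const a ∈ ωPart L → ¬ const b ∉ ωPart L
    const-uniform {a} {b} a∈L b∉L with em {alternate a b ∈ ωPart L}
    ... | yes ab∈L = alternate⇒const L∈𝓥 ab∈L (shift ab∈L) b∉L
    ... | no  ab∉L =
      -- The same argument for `∁ L`, with `a` and `b` exchanged: if baba... were in `L`, shifting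
      -- it by one letter would put abab... in `L`.
      alternate⇒const (∁-closed L∈𝓥) (ab∉L ∘ shift) ab∉L (λ a∉L → a∉L a∈L)

    empty-or-full : (ωPart L ≐ ∅) ⊎ (ωPart L ≐ U)
    empty-or-full with em {∃ λ x → x ∈ ωPart L}
    ... | no  none      = inj₁ ((λ x∈L → none (_ , x∈L)) , λ ())
    -- A word `y` outside `L` would yield a constant word outside `L`, next to the one inside `L`
    -- obtained from `x`.
    ... | yes (x , x∈L) = inj₂ (_ , λ {y} _ → decidable-stable em λ y∉L →
      let a , a∈L = const∈𝓥 L∈𝓥 x x∈L
          b , b∉L = const∈𝓥 (∁-closed L∈𝓥) y y∉L
      in const-uniform a∈L b∉L)

corollary30 : ExcludedMiddle 0ℓ →
    ∀ {v : Level} (𝕍 : ∞Variety v) → let open ∞Variety 𝕍 in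
    (∀ Σ L → L ∈ 𝓥 Σ → Positional (ωPart L)) →
    ∀ Σ L → L ∈ 𝓥 Σ → PrefixIndependent (ωPart L) →
    (ωPart L ≐ ∅) ⊎ (ωPart L ≐ U)
corollary30 em 𝕍 positional Σ L = empty-or-full 𝕍 positional em
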